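{- Let $m_s<m_r$ be positive integers and let $q_s=\lceil (m_s+1)/2\rceil$ and $q_r=\lceil (m_r+1)/2\rceil$. Consider the bicameral simple game with $m_s$ senators, $m_r$ representatives and quotas $q_s,q_r$. In each of the following cases, $c_s(k)>c_r(k)$ for all $k$ such that $c_s(k)\neq 0$: (i) $m_s$ and $m_r$ are both odd; (ii) $m_s$ and $m_r$ are both even; (iii) $m_s$ is even and $m_r$ is odd; (iv) $m_s$ is odd, $m_r$ is even, and $m_r>2m_s$. Thus in these cases, for a senator $S$ and a representative $R$, $\Phi(S)>\Phi(R)$ for any power index $\Phi$ that does not assign power $0$ to both $S$ and $R$.
   Context: The bicameral simple game with $m_s$ senators, $m_r$ representatives and quotas $q_s,q_r$ ($1\le q_s\le m_s$, $1\le q_r\le m_r$) has as players the $n=m_s+m_r$ elements of the disjoint union of a set of $m_s$ senators and a set of $m_r$ representatives; a coalition (set of players) is winning iff it contains at least $q_s$ senators and at least $q_r$ representatives (so the minimal winning coalitions are those with exactly $q_s$ senators and $q_r$ representatives). A player $i$ in a coalition $T$ is critical in $T$ if $T$ is winning and $T\setminus\{i\}$ is not. For a player $i$ and an integer $k$, $c_i(k)$ is the number of coalitions of size $k$ in which $i$ is critical. By symmetry this number is the same for all senators, and is denoted $c_s(k)$; likewise $c_r(k)$ denotes it for a representative. A power index $\Phi$ on a game with $n$ players is given by a weighting vector $(\lambda_1,\dots,\lambda_n)$ with $\lambda_k\ge 0$ for all $k$ and $\sum_{k=1}^n\lambda_k\binom{n-1}{k-1}=1$; the $\Phi$-power of player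 $i$ is $\Phi(i)=\sum_{k=1}^n\lambda_k c_i(k)$. -}

module Defs where

open import Level using (Level; _⊔_; 0ℓ) renaming (suc to lsuc)
open import Algebra.Bundles using (CommutativeRing)
open import Algebra.Core using (Op₁; Op₂)
open import Algebra.Structures using (IsCommutativeRing)
import Algebra.Definitions.RawMonoid as RawMonoidDefinitions
open import Data.Fin using (Fin; toℕ; _↑ˡ_; _↑ʳ_)
open import Data.Fin.Subset using (Subset; inside; outside; ⊤; ⊥; _∈_; _⊆_; _∩_; _-_; ∣_∣)
open import Data.Fin.Subset.Properties using (_∈?_; p⊆q⇒∣p∣≤∣q∣; x∈p∩q⁺; x∈p∩q⁻)
open import Data.List using (List; []; _∷_; length; filter; cartesianProductWith)
open import Data.Nat using (ℕ; zero; suc; _+_; _∸_; _≤_; _≤?_; _≟_)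
open import Data.Nat.Combinatorics using (_C_)
open import Data.Nat.Properties using (≤-trans)
open import Data.Product using (_×_; _,_; ∃; map₁)
open import Data.Vec using (_++_; []; _∷_)
open import Relation.Binary.Core using (Rel)
open import Relation.Binary.Structures using (IsStrictTotalOrder)
open import Relation.Binary.PropositionalEquality using (_≡_)
import Relation.Binary.Construct.StrictToNonStrict as StrictToNonStrict
open import Relation.Nullary using (¬_)
open import Relation.Nullary.Decidable using (_×-dec_; ¬?)
open import Relation.Unary using (Pred; Decidable)

record SimpleGame (n : ℕ) : Set₁ where
  field
    Winning  : Pred (Subset n) 0ℓ
    winning? : Decidable Winning
    monotone : ∀ {T U} → T ⊆ U → Winning T → Winning U

  Critical : Fin n → Pred (Subset n) 0ℓ
  Critical i T = i ∈ T × Winning T × ¬ Winning (T - i)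

  critical? : ∀ i → Decidable (Critical i)
  critical? i T = i ∈? T ×-dec winning? T ×-dec ¬? (winning? (T - i))

-- Each subset of Fin n occurs exactly once.
allSubsets : ∀ n → List (Subset n)
allSubsets zero    = [] ∷ []
allSubsets (suc n) = cartesianProductWith _∷_ (outside ∷ inside ∷ []) (allSubsets n)

criticalCount : ∀ {n} → SimpleGame n → Fin n → ℕ → ℕ
criticalCount {n} G i k =
  length (filter (λ T → critical? i T ×-dec ∣ T ∣ ≟ k) (allSubsets n))
  where open SimpleGame G

-- The disjoint union of the two chambers is Fin (mₛ + mᵣ), senators first.
senator : ∀ {mₛ} mᵣ → Fin mₛ → Fin (mₛ + mᵣ)
senator mᵣ i = i ↑ˡ mᵣ

representative : ∀ mₛ {mᵣ} → Fin mᵣ → Fin (mₛ + mᵣ)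
representative mₛ j = mₛ ↑ʳ j

senators : ∀ mₛ mᵣ → Subset (mₛ + mᵣ)
senators mₛ mᵣ = ⊤ {mₛ} ++ ⊥ {mᵣ}

representatives : ∀ mₛ mᵣ → Subset (mₛ + mᵣ)
representatives mₛ mᵣ = ⊥ {mₛ} ++ ⊤ {mᵣ}

bicameral : (mₛ mᵣ qₛ qᵣ : ℕ) → SimpleGame (mₛ + mᵣ)
bicameral mₛ mᵣ qₛ qᵣ = record
  { Winning  = λ T → qₛ ≤ ∣ T ∩ senators mₛ mᵣ ∣ × qᵣ ≤ ∣ T ∩ representatives mₛ mᵣ ∣
  ; winning? = λ T → (qₛ ≤? ∣ T ∩ senators mₛ mᵣ ∣) ×-dec (qᵣ ≤? ∣ T ∩ representatives mₛ mᵣ ∣)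
  ; monotone = λ { {T} {U} T⊆U (s , r) →
        ≤-trans s (∩-mono T U (senators mₛ mᵣ) T⊆U)
      , ≤-trans r (∩-mono T U (representatives mₛ mᵣ) T⊆U) }
  }
  where
  ∩-mono : ∀ {n} (T U V : Subset n) → T ⊆ U → ∣ T ∩ V ∣ ≤ ∣ U ∩ V ∣
  ∩-mono T U V T⊆U = p⊆q⇒∣p∣≤∣q∣ (λ x∈ → x∈p∩q⁺ (map₁ T⊆U (x∈p∩q⁻ T V x∈)))

-- In place of the reals, the weights of a power index live in an arbitrary
-- ordered field; trichotomy of the order is part of IsStrictTotalOrder.
record OrderedField (c ℓ₁ ℓ₂ : Level) : Set (lsuc (c ⊔ ℓ₁ ⊔ ℓ₂)) where
  infix  8 -ᶠ_
  infixl 7 _*ᶠ_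
  infixl 6 _+ᶠ_
  infix  4 _≈_ _<ᶠ_
  field
    Carrier            : Set c
    _≈_                : Rel Carrier ℓ₁
    _<ᶠ_               : Rel Carrier ℓ₂
    _+ᶠ_ _*ᶠ_          : Op₂ Carrier
    -ᶠ_                : Op₁ Carrier
    0# 1#              : Carrier
    isCommutativeRing  : IsCommutativeRing _≈_ _+ᶠ_ _*ᶠ_ -ᶠ_ 0# 1#
    isStrictTotalOrder : IsStrictTotalOrder _≈_ _<ᶠ_
    0<1                : 0# <ᶠ 1#
    inverse            : ∀ x → ¬ (x ≈ 0#) → ∃ λ y → x *ᶠ y ≈ 1#
    +-monoˡ-<          : ∀ z {x y} → x <ᶠ y → (x +ᶠ z) <ᶠ (y +ᶠ z)
    *-pos              : ∀ {x y} → 0# <ᶠ x → 0# <ᶠ y → 0# <ᶠ x *ᶠ y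

  commutativeRing : CommutativeRing c ℓ₁
  commutativeRing = record { isCommutativeRing = isCommutativeRing }

  open StrictToNonStrict _≈_ _<ᶠ_ public using () renaming (_≤_ to _≤ᶠ_)

  -- k · x is the k-fold sum of x.
  open RawMonoidDefinitions (CommutativeRing.+-rawMonoid commutativeRing) public
    using (sum) renaming (_×_ to _·_)

-- weight k is λ with index toℕ k + 1, as Fin n counts from 0.
record PowerIndex {c ℓ₁ ℓ₂} (F : OrderedField c ℓ₁ ℓ₂) (n : ℕ) : Set (c ⊔ ℓ₁ ⊔ ℓ₂) where
  open OrderedField F
  field
    weight      : Fin n → Carrier
    nonNegative : ∀ k → 0# ≤ᶠ weight k
    normalised  : sum (λ k → ((n ∸ 1) C toℕ k) · weight k) ≈ 1#

  power : SimpleGame n → Fin n → Carrier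
  power G i = sum (λ k → criticalCount G i (suc (toℕ k)) · weight k)

{-# OPTIONS --safe #-}

-- A senator is critical in the coalitions with exactly qₛ senators, the senator
-- among them, and at least qᵣ representatives; so for k = qₛ + qᵣ + t
--   cₛ(k) = C(mₛ - 1, qₛ - 1) C(mᵣ, qᵣ + t),  cᵣ(k) = C(mᵣ - 1, qᵣ - 1) C(mₛ, qₛ + t),
-- and both counts vanish for smaller k. At t = 0 the ratio cₛ / cᵣ is
-- (mᵣ qₛ) / (qᵣ mₛ), and it does not decrease with t as long as qₛ ≤ qᵣ and
-- mᵣ qₛ > qᵣ mₛ. Writing mₛ = v + qₛ and mᵣ = u + qᵣ, the last condition is
-- v qᵣ < u qₛ, which holds in each of the four parity cases.
-- A power index is a nonnegative combination of the counts; a term in which the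
-- senator's is not strictly larger is zero for both players.
module Submission where

open import Defs
open import Level using (0ℓ)
open import Algebra.Bundles using (CommutativeRing)
import Algebra.Properties.Monoid.Mult as MonoidMult
open import Data.Fin using (Fin; zero; suc; toℕ; _↑ˡ_; _↑ʳ_)
open import Data.Fin.Subset using (Subset; Side; inside; outside; ⊤; ⊥; _∈_; _∩_; _-_) renaming (∣_∣ to ∥_∥)
open import Data.Fin.Subset.Properties
  using (_∈?_; ∩-identityʳ; ∩-zeroʳ; ∣⊥∣≡0; p─⊥≡p; x∈p⇒∣p-x∣<∣p∣)
open import Data.List as List using ([]; length; filter)
import Data.List.Properties as List
open import Data.List.Relation.Unary.All using (universal)
open import Data.Nat using (ℕ; zero; suc; _+_; _*_; _∸_; _≤_; _<_; _>_; _≤?_; _≟_; z≤n; s≤s; s<s⁻¹; ⌈_/2⌉; >-nonZero)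
open import Data.Nat.Combinatorics using (_C_; nC1≡n; k>n⇒nCk≡0; nCk+nC[k+1]≡[n+1]C[k+1])
open import Data.Nat.Divisibility using (_∣_; _∤_; divides; ∣m∣n⇒∣m+n)
open import Data.Nat.Properties
open import Data.Nat.Tactic.RingSolver using (solve-∀)
open import Data.Product using (_×_; _,_; ∃; proj₁; proj₂)
open import Data.Sum using (_⊎_; inj₁; inj₂)
open import Data.Vec using ([]; _∷_; _++_; here; there; splitAt)
open import Data.Vec.Properties using (zipWith-++; lookup-++ˡ; lookup-++ʳ; lookup⇒[]=; []=⇒lookup)
open import Function using (_∘_; _⇔_; mk⇔; Equivalence)
open import Relation.Binary.PropositionalEquality
  using (_≡_; _≢_; refl; sym; trans; cong; cong₂; subst; subst₂; module ≡-Reasoning)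
open import Relation.Binary.Structures using (IsStrictTotalOrder)
open import Relation.Nullary using (¬_; yes; no; contradiction)
open import Relation.Nullary.Decidable using (_×-dec_)
open import Relation.Unary using (Pred; Decidable; _≐_)

-- Binomial coefficients.

nC0≡1 : ∀ n → n C 0 ≡ 1
nC0≡1 zero    = refl
nC0≡1 (suc n) = refl

nCk>0 : ∀ {n k} → k ≤ n → 0 < n C k
nCk>0 {n} z≤n = ≤-reflexive (sym (nC0≡1 n))
nCk>0 {suc n} {suc k} (s≤s k≤n) =
  subst (0 <_) (nCk+nC[k+1]≡[n+1]C[k+1] n k) (≤-trans (nCk>0 k≤n) (m≤m+n _ _))

-- The absorption identity, by induction on `n`: Pascal's rule splits the left side, the two
-- induction hypotheses recombine by Pascal into `suc n * x`, and the spare `x` completes the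
-- factor.
[1+k]*[1+n]C[1+k]≡[1+n]*nCk : ∀ n k → suc k * (suc n C suc k) ≡ suc n * (n C k)
[1+k]*[1+n]C[1+k]≡[1+n]*nCk zero    zero    = refl
[1+k]*[1+n]C[1+k]≡[1+n]*nCk zero    (suc k) = *-zeroʳ (suc (suc k))
[1+k]*[1+n]C[1+k]≡[1+n]*nCk (suc n) zero    = begin
  1 * (suc (suc n) C 1)       ≡⟨ *-identityˡ _ ⟩
  suc (suc n) C 1             ≡⟨ nC1≡n (suc (suc n)) ⟩
  suc (suc n)                 ≡⟨ *-identityʳ _ ⟨
  suc (suc n) * 1             ≡⟨ cong (suc (suc n) *_) (nC0≡1 (suc n)) ⟨
  suc (suc n) * (suc n C 0)   ∎
  where open ≡-Reasoning
[1+k]*[1+n]C[1+k]≡[1+n]*nCk (suc n) (suc k) = begin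
  suc (suc k) * (suc (suc n) C suc (suc k))
    ≡⟨ cong (suc (suc k) *_) (nCk+nC[k+1]≡[n+1]C[k+1] (suc n) (suc k)) ⟨
  suc (suc k) * (x + y)
    ≡⟨ expand k x y ⟩
  x + (suc k * x + suc (suc k) * y)
    ≡⟨ cong (x +_) (cong₂ _+_ ([1+k]*[1+n]C[1+k]≡[1+n]*nCk n k) ([1+k]*[1+n]C[1+k]≡[1+n]*nCk n (suc k))) ⟩
  x + (suc n * (n C k) + suc n * (n C suc k))
    ≡⟨ cong (x +_) (*-distribˡ-+ (suc n) (n C k) (n C suc k)) ⟨
  x + suc n * (n C k + n C suc k)
    ≡⟨ cong (λ z → x + suc n * z) (nCk+nC[k+1]≡[n+1]C[k+1] n k) ⟩
  suc (suc n) * x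
    ∎
  where
  open ≡-Reasoning
  x = suc n C suc k
  y = suc n C suc (suc k)
  expand : ∀ k x y → suc (suc k) * (x + y) ≡ x + (suc k * x + suc (suc k) * y)
  expand = solve-∀

-- The ratio of neighbouring entries in a row: add `suc k * (n C k)` to both sides and apply Pascal
-- and absorption. For `k > n` truncated subtraction makes both sides `0`, so no bound on `k` has to
-- be carried along.
[1+k]*nC[1+k]≡[n∸k]*nCk : ∀ n k → suc k * (n C suc k) ≡ (n ∸ k) * (n C k)
[1+k]*nC[1+k]≡[n∸k]*nCk n k with k ≤? n
... | yes k≤n = +-cancelˡ-≡ (suc k * (n C k)) _ _ (begin
  suc k * (n C k) + suc k * (n C suc k)  ≡⟨ *-distribˡ-+ (suc k) (n C k) (n C suc k) ⟨
  suc k * (n C k + n C suc k)            ≡⟨ cong (suc k *_) (nCk+nC[k+1]≡[n+1]C[k+1] n k) ⟩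
  suc k * (suc n C suc k)                ≡⟨ [1+k]*[1+n]C[1+k]≡[1+n]*nCk n k ⟩
  suc n * (n C k)                        ≡⟨ cong (λ z → suc z * (n C k)) (m+[n∸m]≡n k≤n) ⟨
  (suc k + (n ∸ k)) * (n C k)            ≡⟨ *-distribʳ-+ (n C k) (suc k) (n ∸ k) ⟩
  suc k * (n C k) + (n ∸ k) * (n C k)    ∎)
  where open ≡-Reasoning
... | no k≰n = begin
  suc k * (n C suc k)  ≡⟨ cong (suc k *_) (k>n⇒nCk≡0 (m<n⇒m<1+n (≰⇒> k≰n))) ⟩
  suc k * 0            ≡⟨ *-zeroʳ (suc k) ⟩
  0                    ≡⟨ cong (_* (n C k)) (m≤n⇒m∸n≡0 (≰⇒≥ k≰n)) ⟨
  (n ∸ k) * (n C k)    ∎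
  where open ≡-Reasoning

-- Comparison of the two products of binomial coefficients.

module _ {q r u v : ℕ} (q≤r : q ≤ r) (v[1+r]<u[1+q] : v * suc r < u * suc q) where

  -- Raising `suc q` to `suc r` on the right of the hypothesis leaves a common factor to cancel.
  -- Hence the representatives' product, zero for `t > v`, dies out before the senators', zero for
  -- `t > u`.
  v<u : v < u
  v<u = *-cancelʳ-< (suc r) v u (<-≤-trans v[1+r]<u[1+q] (*-monoʳ-≤ u (s≤s q≤r)))

  private
    -- With chamber sizes `suc (v + q)`, `suc (u + r)` and quotas `suc q`, `suc r`, `a` and `b`
    -- count the ways to choose the critical player's companions from the same chamber.
    a = (v + q) C q
    b = (u + r) C r

    absorb : ∀ x y b c → x * y * (b * c) ≡ y * (b * (x * c))
    absorb = solve-∀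
    absorb′ : ∀ x y a c → x * y * (a * c) ≡ x * (a * (y * c))
    absorb′ = solve-∀

  -- The two sides shrink from t to t + 1 by the factors (v ∸ t) / (q + t + 2)
  -- and (u ∸ t) / (r + t + 2), of which the first is the smaller one.
  ratio-≤ : ∀ t → (v ∸ t) * suc (suc (r + t)) ≤ (u ∸ t) * suc (suc (q + t))
  ratio-≤ t with t ≤? v
  ... | no t≰v = ≤-trans (≤-reflexive (cong (_* suc (suc (r + t))) (m≤n⇒m∸n≡0 (≰⇒≥ t≰v)))) z≤n
  -- The factor `suc (suc (s + t))` is `suc s + suc t`. Adding `t * suc r` completes the first part
  -- to `v * suc r`, where the hypothesis applies; `v<u` handles the second part.
  ... | yes t≤v = +-cancelˡ-≤ (t * suc r) _ _ (begin
    t * suc r + (v ∸ t) * suc (suc (r + t))     ≡⟨ expand t r (v ∸ t) ⟩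
    (t + (v ∸ t)) * suc r + (v ∸ t) * suc t     ≡⟨ cong (λ z → z * suc r + (v ∸ t) * suc t) (m+[n∸m]≡n t≤v) ⟩
    v * suc r + (v ∸ t) * suc t                 ≤⟨ +-mono-≤ (<⇒≤ v[1+r]<u[1+q]) (*-monoˡ-≤ (suc t) (∸-monoˡ-≤ t (<⇒≤ v<u))) ⟩
    u * suc q + (u ∸ t) * suc t                 ≡⟨ cong (λ z → z * suc q + (u ∸ t) * suc t) (m+[n∸m]≡n (≤-trans t≤v (<⇒≤ v<u))) ⟨
    (t + (u ∸ t)) * suc q + (u ∸ t) * suc t     ≡⟨ expand t q (u ∸ t) ⟨
    t * suc q + (u ∸ t) * suc (suc (q + t))     ≤⟨ +-monoˡ-≤ _ (*-monoʳ-≤ t (s≤s q≤r)) ⟩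
    t * suc r + (u ∸ t) * suc (suc (q + t))     ∎)
    where
    open ≤-Reasoning
    expand : ∀ t s w → t * suc s + w * suc (suc (s + t)) ≡ (t + w) * suc s + w * suc t
    expand = solve-∀

  -- Induction on `t`. At `0`, clearing denominators by absorption makes both sides multiples of
  -- `a * b`, and what remains is the hypothesis. Afterwards each side is multiplied by its
  -- neighbour ratio, and these are compared by `ratio-≤`.
  binomial-< : ∀ t → t ≤ u →
    b * (suc (v + q) C suc (q + t)) < a * (suc (u + r) C suc (r + t))
  binomial-< zero _ rewrite +-identityʳ q | +-identityʳ r =
    *-cancelˡ-< (suc q * suc r) _ _ (begin-strict
      suc q * suc r * (b * (suc (v + q) C suc q))    ≡⟨ absorb (suc q) (suc r) b _ ⟩
      suc r * (b * (suc q * (suc (v + q) C suc q)))  ≡⟨ cong (λ z → suc r * (b * z)) ([1+k]*[1+n]C[1+k]≡[1+n]*nCk (v + q) q) ⟩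
      suc r * (b * (suc (v + q) * a))                ≡⟨ collectᵛ v q r a b ⟩
      a * b * (suc q * suc r + v * suc r)            <⟨ *-monoʳ-< (a * b) (+-monoʳ-< (suc q * suc r) v[1+r]<u[1+q]) ⟩
      a * b * (suc q * suc r + u * suc q)            ≡⟨ collectᵘ u q r a b ⟩
      suc q * (a * (suc (u + r) * b))                ≡⟨ cong (λ z → suc q * (a * z)) ([1+k]*[1+n]C[1+k]≡[1+n]*nCk (u + r) r) ⟨
      suc q * (a * (suc r * (suc (u + r) C suc r)))  ≡⟨ absorb′ (suc q) (suc r) a _ ⟨
      suc q * suc r * (a * (suc (u + r) C suc r))    ∎)
    where
    open ≤-Reasoning
    instance
      _ = >-nonZero (*-mono-≤ (nCk>0 (m≤n+m q v)) (nCk>0 (m≤n+m r u)))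
    collectᵛ : ∀ v q r a b → suc r * (b * (suc (v + q) * a)) ≡ a * b * (suc q * suc r + v * suc r)
    collectᵛ = solve-∀
    collectᵘ : ∀ u q r a b → a * b * (suc q * suc r + u * suc q) ≡ suc q * (a * (suc (u + r) * b))
    collectᵘ = solve-∀
  binomial-< (suc t) t<u rewrite +-suc q t | +-suc r t =
    *-cancelˡ-< (x * y) _ _ (begin-strict
      x * y * (b * (suc (v + q) C x))     ≡⟨ absorb x y b _ ⟩
      y * (b * (x * (suc (v + q) C x)))   ≡⟨ cong (λ z → y * (b * z)) (step v q) ⟩
      y * (b * ((v ∸ t) * V))             ≡⟨ regroup y b (v ∸ t) V ⟩
      (v ∸ t) * y * (b * V)               ≤⟨ *-monoˡ-≤ (b * V) (ratio-≤ t) ⟩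
      (u ∸ t) * x * (b * V)               <⟨ *-monoʳ-< ((u ∸ t) * x) (binomial-< t (<⇒≤ t<u)) ⟩
      (u ∸ t) * x * (a * U)               ≡⟨ regroup x a (u ∸ t) U ⟨
      x * (a * ((u ∸ t) * U))             ≡⟨ cong (λ z → x * (a * z)) (step u r) ⟨
      x * (a * (y * (suc (u + r) C y)))   ≡⟨ absorb′ x y a _ ⟨
      x * y * (a * (suc (u + r) C y))     ∎)
    where
    open ≤-Reasoning
    x = suc (suc (q + t))
    y = suc (suc (r + t))
    V = suc (v + q) C suc (q + t)
    U = suc (u + r) C suc (r + t)
    -- The induction hypothesis stays strict only under a positive factor, so `u ∸ t` must not
    -- vanish; this is where `t < u` enters.
    instance
      _ = >-nonZero (*-mono-≤ {1} {u ∸ t} {1} {x} (m<n⇒0<n∸m t<u) (s≤s z≤n))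
    step : ∀ w s → suc (suc (s + t)) * (suc (w + s) C suc (suc (s + t)))
                 ≡ (w ∸ t) * (suc (w + s) C suc (s + t))
    step w s = trans ([1+k]*nC[1+k]≡[n∸k]*nCk (suc (w + s)) (suc (s + t)))
      (cong (_* (suc (w + s) C suc (s + t)))
        (trans (cong (_∸ (s + t)) (+-comm w s)) ([m+n]∸[m+o]≡n∸o s w t)))
    regroup : ∀ y b w c → y * (b * (w * c)) ≡ w * y * (b * c)
    regroup = solve-∀

-- Counting subsets.

#_ : ∀ {n} {P : Pred (Subset n) 0ℓ} → Decidable P → ℕ
#_ {n} P? = length (filter P? (allSubsets n))

#-cong : ∀ {n} {P Q : Pred (Subset n) 0ℓ} (P? : Decidable P) (Q? : Decidable Q) → P ≐ Q → # P? ≡ # Q?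
#-cong {n} P? Q? P≐Q = cong length (List.filter-≐ P? Q? P≐Q (allSubsets n))

#-empty : ∀ {n} {P : Pred (Subset n) 0ℓ} (P? : Decidable P) → (∀ T → ¬ P T) → # P? ≡ 0
#-empty {n} P? ¬P = cong length (List.filter-none P? (universal ¬P (allSubsets n)))

length-filter-map : ∀ {A B : Set} {P : Pred B 0ℓ} (P? : Decidable P) (f : A → B) xs →
  length (filter P? (List.map f xs)) ≡ length (filter (P? ∘ f) xs)
length-filter-map P? f []             = refl
length-filter-map P? f (x List.∷ xs) with P? (f x)
... | yes _ = cong suc (length-filter-map P? f xs)
... | no  _ = length-filter-map P? f xs

#-∷ : ∀ {n} {P : Pred (Subset (suc n)) 0ℓ} (P? : Decidable P) →
  # P? ≡ # (P? ∘ (outside ∷_)) + # (P? ∘ (inside ∷_))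
#-∷ {n} P? = begin
  -- `allSubsets (suc n)` unfolds to these two blocks followed by an empty list.
  length (filter P? (os List.++ is List.++ []))
    ≡⟨ cong (λ z → length (filter P? (os List.++ z))) (List.++-identityʳ is) ⟩
  length (filter P? (os List.++ is))
    ≡⟨ cong length (List.filter-++ P? os is) ⟩
  length (filter P? os List.++ filter P? is)
    ≡⟨ List.length-++ (filter P? os) ⟩
  length (filter P? os) + length (filter P? is)
    ≡⟨ cong₂ _+_ (length-filter-map P? (outside ∷_) (allSubsets n)) (length-filter-map P? (inside ∷_) (allSubsets n)) ⟩
  # (P? ∘ (outside ∷_)) + # (P? ∘ (inside ∷_)) ∎
  where
  open ≡-Reasoning
  os = List.map (outside ∷_) (allSubsets n)
  is = List.map (inside ∷_) (allSubsets n)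

-- Induction on the left block: splitting on its first element turns `# R?` and `# P?` into sums,
-- and the product distributes. With an empty block `# P?` is `1` or `0`, as `P? []` decides. An
-- equivalence on concatenations suffices, so `R` need not be a product by definition.
#-++ : ∀ {m n} {P : Pred (Subset m) 0ℓ} {Q : Pred (Subset n) 0ℓ} {R : Pred (Subset (m + n)) 0ℓ}
  (P? : Decidable P) (Q? : Decidable Q) (R? : Decidable R) →
  (∀ U V → R (U ++ V) ⇔ (P U × Q V)) → # R? ≡ # P? * # Q?
#-++ {zero} P? Q? R? R⇔P×Q with P? []
... | yes p = trans
  (#-cong R? Q? ((λ {V} → proj₂ ∘ Equivalence.to (R⇔P×Q [] V)) , λ {V} q → Equivalence.from (R⇔P×Q [] V) (p , q)))
  (sym (*-identityˡ _))
... | no ¬p = #-empty R? λ V → ¬p ∘ proj₁ ∘ Equivalence.to (R⇔P×Q [] V)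
#-++ {suc m} P? Q? R? R⇔P×Q = begin
  # R?                                                            ≡⟨ #-∷ R? ⟩
  # (R? ∘ (outside ∷_)) + # (R? ∘ (inside ∷_))                    ≡⟨ cong₂ _+_ (part outside) (part inside) ⟩
  # (P? ∘ (outside ∷_)) * # Q? + # (P? ∘ (inside ∷_)) * # Q?      ≡⟨ *-distribʳ-+ (# Q?) (# (P? ∘ (outside ∷_))) _ ⟨
  (# (P? ∘ (outside ∷_)) + # (P? ∘ (inside ∷_))) * # Q?           ≡⟨ cong (_* # Q?) (#-∷ P?) ⟨
  # P? * # Q?                                                     ∎
  where
  open ≡-Reasoning
  part : ∀ (s : Side) → # (R? ∘ (s ∷_)) ≡ # (P? ∘ (s ∷_)) * # Q?
  part s = #-++ (P? ∘ (s ∷_)) Q? (R? ∘ (s ∷_)) (λ U V → R⇔P×Q (s ∷ U) V)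

#-size : ∀ n k → # (λ (T : Subset n) → ∥ T ∥ ≟ k) ≡ n C k
#-size zero    zero    = refl
#-size zero    (suc k) = refl
#-size (suc n) zero    = begin
  # (λ (T : Subset (suc n)) → ∥ T ∥ ≟ 0)                        ≡⟨ #-∷ {n} (λ T → ∥ T ∥ ≟ 0) ⟩
  # (λ (T : Subset n) → ∥ T ∥ ≟ 0) + # (λ (T : Subset n) → suc ∥ T ∥ ≟ 0)
    ≡⟨ cong₂ _+_ (#-size n 0) (#-empty {n} (λ T → suc ∥ T ∥ ≟ 0) λ _ ()) ⟩
  n C 0 + 0    ≡⟨ +-identityʳ _ ⟩
  n C 0        ≡⟨ trans (nC0≡1 n) (sym (nC0≡1 (suc n))) ⟩
  suc n C 0    ∎
  where open ≡-Reasoning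
#-size (suc n) (suc k) = begin
  # (λ (T : Subset (suc n)) → ∥ T ∥ ≟ suc k)                    ≡⟨ #-∷ {n} (λ T → ∥ T ∥ ≟ suc k) ⟩
  # (λ (T : Subset n) → ∥ T ∥ ≟ suc k) + # (λ (T : Subset n) → suc ∥ T ∥ ≟ suc k)
    ≡⟨ cong₂ _+_ (#-size n (suc k)) (trans (#-cong {n} _ _ (suc-injective , cong suc)) (#-size n k)) ⟩
  n C suc k + n C k   ≡⟨ +-comm (n C suc k) _ ⟩
  n C k + n C suc k   ≡⟨ nCk+nC[k+1]≡[n+1]C[k+1] n k ⟩
  suc n C suc k       ∎
  where open ≡-Reasoning

-- Apart from `i`, the set has `k` members among the other `n` elements. If `i` is not the head, the
-- sets without and with the head give the two terms of Pascal's rule.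
#-∋-size : ∀ n (i : Fin (suc n)) k → # (λ T → i ∈? T ×-dec ∥ T ∥ ≟ suc k) ≡ n C k
#-∋-size n zero k = begin
  # (λ (T : Subset (suc n)) → zero ∈? T ×-dec ∥ T ∥ ≟ suc k)
    ≡⟨ #-∷ {n} (λ (T : Subset (suc n)) → zero ∈? T ×-dec ∥ T ∥ ≟ suc k) ⟩
  # (λ (T : Subset n) → zero ∈? (outside ∷ T) ×-dec ∥ T ∥ ≟ suc k) + # (λ (T : Subset n) → zero ∈? (inside ∷ T) ×-dec suc ∥ T ∥ ≟ suc k)
    ≡⟨ cong₂ _+_ (#-empty {n} _ λ { _ (() , _) })
         (#-cong {n} _ (λ T → ∥ T ∥ ≟ k) (suc-injective ∘ proj₂ , λ eq → here , cong suc eq)) ⟩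
  # (λ (T : Subset n) → ∥ T ∥ ≟ k)
    ≡⟨ #-size n k ⟩
  n C k ∎
  where open ≡-Reasoning
#-∋-size (suc n) (suc i) k = begin
  # (λ T → suc i ∈? T ×-dec ∥ T ∥ ≟ suc k)
    ≡⟨ #-∷ {suc n} (λ T → suc i ∈? T ×-dec ∥ T ∥ ≟ suc k) ⟩
  # (λ T → suc i ∈? (outside ∷ T) ×-dec ∥ T ∥ ≟ suc k) + # (λ T → suc i ∈? (inside ∷ T) ×-dec suc ∥ T ∥ ≟ suc k)
    ≡⟨ cong₂ _+_
         (trans (#-cong {suc n} _ (λ T → i ∈? T ×-dec ∥ T ∥ ≟ suc k)
                  ((λ { (there i∈T , eq) → i∈T , eq }) , λ { (i∈T , eq) → there i∈T , eq }))
                (#-∋-size n i k))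
         (#-cong {suc n} _ (λ T → i ∈? T ×-dec ∥ T ∥ ≟ k)
           ((λ { (there i∈T , eq) → i∈T , suc-injective eq }) , λ { (i∈T , eq) → there i∈T , cong suc eq })) ⟩
  n C k + # (λ T → i ∈? T ×-dec ∥ T ∥ ≟ k)
    ≡⟨ pascal k ⟩
  suc n C k ∎
  where
  open ≡-Reasoning
  -- The induction hypothesis speaks of sizes `suc k` only; size `0` is separate, as no set
  -- containing `i` is empty.
  pascal : ∀ k → n C k + # (λ T → i ∈? T ×-dec ∥ T ∥ ≟ k) ≡ suc n C k
  pascal zero = trans
    (cong₂ _+_ (nC0≡1 n) (#-empty {suc n} _ λ T (i∈T , eq) →
      contradiction (≤-trans (x∈p⇒∣p-x∣<∣p∣ i∈T) (≤-reflexive eq)) λ ()))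
    (sym (nC0≡1 (suc n)))
  pascal (suc k) = trans (cong (n C suc k +_) (#-∋-size n i k))
    (trans (+-comm (n C suc k) _) (nCk+nC[k+1]≡[n+1]C[k+1] n k))

-- Coalitions as concatenations of senators and representatives.

∥++∥ : ∀ {m n} (U : Subset m) (V : Subset n) → ∥ U ++ V ∥ ≡ ∥ U ∥ + ∥ V ∥
∥++∥ []            V = refl
∥++∥ (outside ∷ U) V = ∥++∥ U V
∥++∥ (inside  ∷ U) V = cong suc (∥++∥ U V)

∈-++ˡ : ∀ {m n} (U : Subset m) (V : Subset n) i → i ↑ˡ n ∈ U ++ V ⇔ i ∈ U
∈-++ˡ U V i = mk⇔
  (λ i∈ → lookup⇒[]= i U (trans (sym (lookup-++ˡ U V i)) ([]=⇒lookup i∈)))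
  (λ i∈ → lookup⇒[]= _ (U ++ V) (trans (lookup-++ˡ U V i) ([]=⇒lookup i∈)))

∈-++ʳ : ∀ {m n} (U : Subset m) (V : Subset n) j → m ↑ʳ j ∈ U ++ V ⇔ j ∈ V
∈-++ʳ U V j = mk⇔
  (λ j∈ → lookup⇒[]= j V (trans (sym (lookup-++ʳ U V j)) ([]=⇒lookup j∈)))
  (λ j∈ → lookup⇒[]= _ (U ++ V) (trans (lookup-++ʳ U V j) ([]=⇒lookup j∈)))

-‿++ˡ : ∀ {m n} (U : Subset m) (V : Subset n) i → (U ++ V) - (i ↑ˡ n) ≡ (U - i) ++ V
-‿++ˡ (s ∷ U) V zero    = cong (_ ∷_) (trans (p─⊥≡p (U ++ V)) (cong (_++ V) (sym (p─⊥≡p U))))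
-‿++ˡ (s ∷ U) V (suc i) = cong (_ ∷_) (-‿++ˡ U V i)

-‿++ʳ : ∀ {m n} (U : Subset m) (V : Subset n) j → (U ++ V) - (m ↑ʳ j) ≡ U ++ (V - j)
-‿++ʳ []      V j = refl
-‿++ʳ (s ∷ U) V j = cong (_ ∷_) (-‿++ʳ U V j)

∥∩senators∥ : ∀ {m n} (U : Subset m) (V : Subset n) → ∥ (U ++ V) ∩ senators m n ∥ ≡ ∥ U ∥
∥∩senators∥ {m} {n} U V = begin
  ∥ (U ++ V) ∩ senators m n ∥    ≡⟨ cong ∥_∥ (zipWith-++ _ U V ⊤ ⊥) ⟩
  ∥ (U ∩ ⊤) ++ (V ∩ ⊥) ∥         ≡⟨ ∥++∥ (U ∩ ⊤) (V ∩ ⊥) ⟩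
  ∥ U ∩ ⊤ ∥ + ∥ V ∩ ⊥ ∥          ≡⟨ cong₂ _+_ (cong ∥_∥ (∩-identityʳ U)) (trans (cong ∥_∥ (∩-zeroʳ V)) (∣⊥∣≡0 n)) ⟩
  ∥ U ∥ + 0                      ≡⟨ +-identityʳ _ ⟩
  ∥ U ∥                          ∎
  where open ≡-Reasoning

∥∩representatives∥ : ∀ {m n} (U : Subset m) (V : Subset n) → ∥ (U ++ V) ∩ representatives m n ∥ ≡ ∥ V ∥
∥∩representatives∥ {m} {n} U V = begin
  ∥ (U ++ V) ∩ representatives m n ∥    ≡⟨ cong ∥_∥ (zipWith-++ _ U V ⊥ ⊤) ⟩
  ∥ (U ∩ ⊥) ++ (V ∩ ⊤) ∥                ≡⟨ ∥++∥ (U ∩ ⊥) (V ∩ ⊤) ⟩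
  ∥ U ∩ ⊥ ∥ + ∥ V ∩ ⊤ ∥                 ≡⟨ cong₂ _+_ (trans (cong ∥_∥ (∩-zeroʳ U)) (∣⊥∣≡0 m)) (cong ∥_∥ (∩-identityʳ V)) ⟩
  ∥ V ∥                                 ∎
  where open ≡-Reasoning

1+∥p-x∥≡∥p∥ : ∀ {n} (p : Subset n) {x} → x ∈ p → suc ∥ p - x ∥ ≡ ∥ p ∥
1+∥p-x∥≡∥p∥ (inside  ∷ p) here        = cong (suc ∘ ∥_∥) (p─⊥≡p p)
1+∥p-x∥≡∥p∥ (outside ∷ p) (there x∈p) = 1+∥p-x∥≡∥p∥ p x∈p
1+∥p-x∥≡∥p∥ (inside  ∷ p) (there x∈p) = cong suc (1+∥p-x∥≡∥p∥ p x∈p)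

-- Removing a member lowers the size by exactly one, so a quota lost in this way was met with
-- nothing to spare.
threshold-≡ : ∀ {n q} (p : Subset n) {x} → x ∈ p → q ≤ ∥ p ∥ → ¬ q ≤ ∥ p - x ∥ → ∥ p ∥ ≡ q
threshold-≡ p x∈p q≤ q≰ = ≤-antisym (≤-trans (≤-reflexive (sym (1+∥p-x∥≡∥p∥ p x∈p))) (≰⇒> q≰)) q≤

-- Critical coalitions of the bicameral game and their number.

module _ {m n q r : ℕ} where

  private
    G = bicameral m n q r
    open SimpleGame G using (Winning; Critical; critical?)

  winning-++ : ∀ (U : Subset m) (V : Subset n) → Winning (U ++ V) ⇔ (q ≤ ∥ U ∥ × r ≤ ∥ V ∥)
  winning-++ U V rewrite ∥∩senators∥ U V | ∥∩representatives∥ U V = mk⇔ (λ z → z) (λ z → z)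

  -- Removing a senator leaves `V` unchanged, so the win can only be lost through the senators'
  -- quota, and `threshold-≡` applies to `U`.
  critical-senator : ∀ i (U : Subset m) (V : Subset n) → Critical (senator n i) (U ++ V) ⇔ ((i ∈ U × ∥ U ∥ ≡ q) × r ≤ ∥ V ∥)
  critical-senator i U V rewrite -‿++ˡ U V i = mk⇔
    (λ (i∈T , win , lose) →
      let i∈U = Equivalence.to (∈-++ˡ U V i) i∈T
          q≤U , r≤V = Equivalence.to (winning-++ U V) win
      in (i∈U , threshold-≡ U i∈U q≤U λ q≤ → lose (Equivalence.from (winning-++ (U - i) V) (q≤ , r≤V))) , r≤V)
    (λ ((i∈U , U≡q) , r≤V) →
        Equivalence.from (∈-++ˡ U V i) i∈U
      , Equivalence.from (winning-++ U V) (≤-reflexive (sym U≡q) , r≤V)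
      , λ win → <⇒≱ (<-≤-trans (x∈p⇒∣p-x∣<∣p∣ i∈U) (≤-reflexive U≡q))
                    (proj₁ (Equivalence.to (winning-++ (U - i) V) win)))

  critical-representative : ∀ j (U : Subset m) (V : Subset n) →
    Critical (representative m j) (U ++ V) ⇔ (q ≤ ∥ U ∥ × (j ∈ V × ∥ V ∥ ≡ r))
  critical-representative j U V rewrite -‿++ʳ U V j = mk⇔
    (λ (j∈T , win , lose) →
      let j∈V = Equivalence.to (∈-++ʳ U V j) j∈T
          q≤U , r≤V = Equivalence.to (winning-++ U V) win
      in q≤U , (j∈V , threshold-≡ V j∈V r≤V λ r≤ → lose (Equivalence.from (winning-++ U (V - j)) (q≤U , r≤))))
    (λ (q≤U , (j∈V , V≡r)) →
        Equivalence.from (∈-++ʳ U V j) j∈V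
      , Equivalence.from (winning-++ U V) (q≤U , ≤-reflexive (sym V≡r))
      , λ win → <⇒≱ (<-≤-trans (x∈p⇒∣p-x∣<∣p∣ j∈V) (≤-reflexive V≡r))
                    (proj₂ (Equivalence.to (winning-++ U (V - j)) win)))

  critical⇒q+r≤ : ∀ {p k} T → Critical p T → ∥ T ∥ ≡ k → q + r ≤ k
  critical⇒q+r≤ T (_ , win , _) refl with splitAt m T
  ... | U , V , refl = let q≤U , r≤V = Equivalence.to (winning-++ U V) win in
    ≤-trans (+-mono-≤ q≤U r≤V) (≤-reflexive (sym (∥++∥ U V)))

  criticalCount-small : ∀ p {k} → k < q + r → criticalCount G p k ≡ 0
  criticalCount-small p {k} k<q+r =
    -- `criticalCount` unfolds to `#_` of this predicate, so the counting lemmas apply directly.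
    #-empty (λ T → critical? p T ×-dec ∥ T ∥ ≟ k) λ T (crit , eq) → <⇒≱ k<q+r (critical⇒q+r≤ T crit eq)

-- Exactly `suc q` senators in a coalition of this size leave `r + t` representatives, which already
-- meets their quota. The conditions on the two chambers thus separate.
criticalCount-senator : ∀ m n q r i t →
  criticalCount (bicameral (suc m) n (suc q) r) (senator n i) (suc q + r + t) ≡ (m C q) * (n C (r + t))
criticalCount-senator m n q r i t = trans
  (#-++ (λ U → i ∈? U ×-dec ∥ U ∥ ≟ suc q) (λ (V : Subset n) → ∥ V ∥ ≟ r + t) _ λ U V → mk⇔
    (λ (crit , eq) →
      let (i∈U , U≡q) , _ = Equivalence.to (critical-senator i U V) crit
      in (i∈U , U≡q) , +-cancelˡ-≡ (suc q) _ _
           (trans (cong (_+ ∥ V ∥) (sym U≡q)) (trans (sym (∥++∥ U V)) (trans eq (+-assoc (suc q) r t)))))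
    (λ (crit , V≡) →
        Equivalence.from (critical-senator i U V) (crit , ≤-trans (m≤m+n r t) (≤-reflexive (sym V≡)))
      , trans (∥++∥ U V) (trans (cong₂ _+_ (proj₂ crit) V≡) (sym (+-assoc (suc q) r t)))))
  (cong₂ _*_ (#-∋-size m i q) (#-size n (r + t)))

criticalCount-representative : ∀ m n q r j t →
  criticalCount (bicameral m (suc n) q (suc r)) (representative m j) (q + suc r + t) ≡ (n C r) * (m C (q + t))
criticalCount-representative m n q r j t = trans
  (#-++ (λ (U : Subset m) → ∥ U ∥ ≟ q + t) (λ V → j ∈? V ×-dec ∥ V ∥ ≟ suc r) _ λ U V → mk⇔
    (λ (crit , eq) →
      let _ , (j∈V , V≡r) = Equivalence.to (critical-representative j U V) crit
      in +-cancelʳ-≡ (suc r) _ _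
           (trans (cong (∥ U ∥ +_) (sym V≡r)) (trans (sym (∥++∥ U V)) (trans eq (swap q (suc r) t)))) , (j∈V , V≡r))
    (λ (U≡ , crit) →
        Equivalence.from (critical-representative j U V) (≤-trans (m≤m+n q t) (≤-reflexive (sym U≡)) , crit)
      , trans (∥++∥ U V) (trans (cong₂ _+_ U≡ (proj₂ crit)) (sym (swap q (suc r) t)))))
  -- The factors are swapped so that the critical player's own chamber comes first, as in
  -- `binomial-<`.
  (trans (cong₂ _*_ (#-size m (q + t)) (#-∋-size n j r)) (*-comm (m C (q + t)) _))
  where
  swap : ∀ q r t → q + r + t ≡ q + t + r
  swap = solve-∀

-- The quotas enter through equations so that a rounded half can be replaced by its successor form.
-- The second alternative covers the sizes at which both counts vanish, too small or too large.
criticalCount-< : ∀ {qₛ qᵣ q r u v} → qₛ ≡ suc q → qᵣ ≡ suc r → q ≤ r → v * suc r < u * suc q →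
  ∀ (i : Fin (suc (v + q))) (j : Fin (suc (u + r))) k →
  let m = suc (v + q)
      n = suc (u + r)
      G = bicameral m n qₛ qᵣ
      cₛ = criticalCount G (senator {m} n i) k
      cᵣ = criticalCount G (representative m {n} j) k
  in cᵣ < cₛ ⊎ (cᵣ ≡ 0 × cₛ ≡ 0)
criticalCount-< {q = q} {r} {u} {v} refl refl q≤r H i j k with suc q + suc r ≤? k
... | no k≱ = inj₂ ( criticalCount-small {suc (v + q)} {suc (u + r)} {suc q} {suc r} (representative (suc (v + q)) j) (≰⇒> k≱)
                   , criticalCount-small {suc (v + q)} {suc (u + r)} {suc q} {suc r} (senator (suc (u + r)) i) (≰⇒> k≱))
... | yes k≥ = subst (λ k → cᵣ k < cₛ k ⊎ (cᵣ k ≡ 0 × cₛ k ≡ 0)) (m+[n∸m]≡n k≥) (shifted (k ∸ (suc q + suc r)))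
  where
  m = suc (v + q)
  n = suc (u + r)
  G = bicameral m n (suc q) (suc r)
  cₛ = criticalCount G (senator {m} n i)
  cᵣ = criticalCount G (representative m {n} j)
  vanish : ∀ a w s {t} → w < t → a * (suc (w + s) C suc (s + t)) ≡ 0
  vanish a w s {t} w<t = trans
    (cong (a *_) (k>n⇒nCk≡0 (s≤s (≤-trans (+-monoˡ-< s w<t) (≤-reflexive (+-comm t s))))))
    (*-zeroʳ a)
  cₛ≡ = criticalCount-senator (v + q) n q (suc r) i
  cᵣ≡ = criticalCount-representative m (u + r) (suc q) r j
  shifted : ∀ t → let k = suc q + suc r + t in cᵣ k < cₛ k ⊎ (cᵣ k ≡ 0 × cₛ k ≡ 0)
  shifted t with t ≤? u
  ... | yes t≤u = inj₁ (subst₂ _<_ (sym (cᵣ≡ t)) (sym (cₛ≡ t)) (binomial-< q≤r H t t≤u))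
  -- Here `v < u < t`, so each chamber is smaller than the number of members to be chosen from it.
  ... | no t≰u  = inj₂
    ( trans (cᵣ≡ t) (vanish ((u + r) C r) v q (<-trans (v<u q≤r H) (≰⇒> t≰u)))
    , trans (cₛ≡ t) (vanish ((v + q) C q) u r (≰⇒> t≰u)))

-- Strict comparison of weighted sums in an ordered field.

module OrderedFieldProperties {c ℓ₁ ℓ₂} (F : OrderedField c ℓ₁ ℓ₂) where

  open OrderedField F renaming (+-monoˡ-< to +-monoˡ-<ᶠ)
  open IsStrictTotalOrder isStrictTotalOrder using (<-respˡ-≈; <-respʳ-≈) renaming (trans to <ᶠ-trans)
  open CommutativeRing commutativeRing
    using (+-monoid)
    renaming ( +-comm to +-commᶠ; +-cong to +-congᶠ; +-identityˡ to +-identityˡᶠ; +-identityʳ to +-identityʳᶠ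
             ; refl to ≈-refl; sym to ≈-sym; trans to ≈-trans)
  open MonoidMult +-monoid using (×-congʳ)

  +-monoʳ-<ᶠ : ∀ z {x y} → x <ᶠ y → (z +ᶠ x) <ᶠ (z +ᶠ y)
  +-monoʳ-<ᶠ z {x} {y} x<y = <-respˡ-≈ (+-commᶠ x z) (<-respʳ-≈ (+-commᶠ y z) (+-monoˡ-<ᶠ z x<y))

  ·-zeroʳ : ∀ n → n · 0# ≈ 0#
  ·-zeroʳ zero    = ≈-refl
  ·-zeroʳ (suc n) = ≈-trans (+-identityˡᶠ (n · 0#)) (·-zeroʳ n)

  0<[1+n]·x : ∀ n {x} → 0# <ᶠ x → 0# <ᶠ suc n · x
  0<[1+n]·x zero    {x} 0<x = <-respʳ-≈ (≈-sym (+-identityʳᶠ x)) 0<x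
  0<[1+n]·x (suc n) {x} 0<x = <ᶠ-trans 0<x (<-respˡ-≈ (+-identityʳᶠ x) (+-monoʳ-<ᶠ x (0<[1+n]·x n 0<x)))

  ·-monoˡ-< : ∀ {m n x} → 0# <ᶠ x → m < n → m · x <ᶠ n · x
  ·-monoˡ-< {zero}  {suc n}     0<x _         = 0<[1+n]·x n 0<x
  ·-monoˡ-< {suc m} {suc n} {x} 0<x (s≤s m<n) = +-monoʳ-<ᶠ x (·-monoˡ-< 0<x m<n)

  infix 4 _<∨0_
  -- Strict inequality fails for terms that are zero on both sides, and weak inequality loses
  -- strictness in the sum. This relation admits zero terms, is preserved by addition, and is strict
  -- as soon as one side is nonzero.
  _<∨0_ : Carrier → Carrier → Set _
  x <∨0 y = x <ᶠ y ⊎ (x ≈ 0# × y ≈ 0#)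

  +-mono-<∨0 : ∀ {x y z w} → x <∨0 y → z <∨0 w → (x +ᶠ z) <∨0 (y +ᶠ w)
  +-mono-<∨0 {y = y} {z} (inj₁ x<y) (inj₁ z<w) =
    inj₁ (<ᶠ-trans (+-monoˡ-<ᶠ z x<y) (+-monoʳ-<ᶠ y z<w))
  +-mono-<∨0 {x} {y} {z} {w} (inj₁ x<y) (inj₂ (z≈0 , w≈0)) =
    inj₁ (<-respʳ-≈ (+-congᶠ ≈-refl (≈-trans z≈0 (≈-sym w≈0))) (+-monoˡ-<ᶠ z x<y))
  +-mono-<∨0 {x} (inj₂ (x≈0 , y≈0)) (inj₁ z<w) =
    inj₁ (<-respʳ-≈ (+-congᶠ (≈-trans x≈0 (≈-sym y≈0)) ≈-refl) (+-monoʳ-<ᶠ x z<w))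
  +-mono-<∨0 (inj₂ (x≈0 , y≈0)) (inj₂ (z≈0 , w≈0)) =
    inj₂ ( ≈-trans (+-congᶠ x≈0 z≈0) (+-identityˡᶠ 0#)
         , ≈-trans (+-congᶠ y≈0 w≈0) (+-identityˡᶠ 0#))

  sum-mono-<∨0 : ∀ {n} (f g : Fin n → Carrier) → (∀ k → f k <∨0 g k) → sum f <∨0 sum g
  sum-mono-<∨0 {zero}  f g f<g = inj₂ (≈-refl , ≈-refl)
  sum-mono-<∨0 {suc n} f g f<g = +-mono-<∨0 (f<g zero) (sum-mono-<∨0 (f ∘ suc) (g ∘ suc) (f<g ∘ suc))

  -- A positive weight preserves either alternative; a zero weight sends both sides to `0#`,
  -- whatever the counts.
  ·-mono-<∨0 : ∀ {m n x} → 0# ≤ᶠ x → m < n ⊎ (m ≡ 0 × n ≡ 0) → m · x <∨0 n · x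
  ·-mono-<∨0 (inj₁ 0<x) (inj₁ m<n)           = inj₁ (·-monoˡ-< 0<x m<n)
  ·-mono-<∨0 (inj₁ 0<x) (inj₂ (refl , refl)) = inj₂ (≈-refl , ≈-refl)
  ·-mono-<∨0 {m} {n} (inj₂ 0≈x) _            =
    inj₂ ( ≈-trans (×-congʳ m (≈-sym 0≈x)) (·-zeroʳ m)
         , ≈-trans (×-congʳ n (≈-sym 0≈x)) (·-zeroʳ n))

-- Both conclusions discard the zero alternative: the first by the nonzero count, the second, after
-- summation, by the nonzero power.
dominance : ∀ {c ℓ₁ ℓ₂ n} (G : SimpleGame n) (R S : Fin n) →
  (∀ k → criticalCount G R k < criticalCount G S k ⊎ (criticalCount G R k ≡ 0 × criticalCount G S k ≡ 0)) →
  (∀ k → criticalCount G S k ≢ 0 → criticalCount G S k > criticalCount G R k)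
  ×
  (∀ (F : OrderedField c ℓ₁ ℓ₂) (Φ : PowerIndex F n) →
    let open OrderedField F
        open PowerIndex Φ in
    ¬ (power G S ≈ 0# × power G R ≈ 0#) → power G R <ᶠ power G S)
dominance {n = n} G R S c< = counts , powers
  where
  counts : ∀ k → criticalCount G S k ≢ 0 → criticalCount G S k > criticalCount G R k
  counts k ≢0 with c< k
  ... | inj₁ lt       = lt
  ... | inj₂ (_ , ≡0) = contradiction ≡0 ≢0
  powers : ∀ F (Φ : PowerIndex F n) → let open OrderedField F; open PowerIndex Φ in
    ¬ (power G S ≈ 0# × power G R ≈ 0#) → power G R <ᶠ power G S
  powers F Φ ¬0 with OrderedFieldProperties.sum-mono-<∨0 F _ _ (λ k → OrderedFieldProperties.·-mono-<∨0 F (PowerIndex.nonNegative Φ k) (c< (suc (toℕ k))))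
  ... | inj₁ lt          = lt
  ... | inj₂ (R≈0 , S≈0) = contradiction (S≈0 , R≈0) ¬0

-- Majority quotas in the parity cases.

even-pred : ∀ {m} → 2 ∣ suc m → ∃ λ x → m ≡ x + suc x
even-pred (divides (suc k) refl) = k , double k
  where
  double : ∀ k → suc (k * 2) ≡ k + suc k
  double = solve-∀

odd-pred : ∀ m → 2 ∤ suc m → ∃ λ x → m ≡ x + x
odd-pred zero          _     = 0 , refl
odd-pred (suc zero)    2∤2   = contradiction (divides 1 refl) 2∤2
odd-pred (suc (suc m)) 2∤m+3 with odd-pred m (2∤m+3 ∘ ∣m∣n⇒∣m+n (divides 1 refl))
... | x , refl = suc x , cong suc (sym (+-suc x x))

-- Puts a chamber of `2x + 1` into the form `suc (v + q)` with quota `suc q`, where `v = q = x`. For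
-- `2x + 2` members the values are `v = x` and `q = suc x`.
majority-odd : ∀ x → ⌈ suc (x + x) + 1 /2⌉ ≡ suc x
majority-odd x = trans (cong ⌈_/2⌉ (+-comm (suc (x + x)) 1)) (cong suc (sym (n≡⌈n+n/2⌉ x)))

majority-even : ∀ x → ⌈ suc (x + suc x) + 1 /2⌉ ≡ suc (suc x)
majority-even x = trans
  (cong ⌈_/2⌉ (trans (+-comm (suc (x + suc x)) 1) (cong (2 +_) (+-suc x x))))
  (cong (2 +_) (sym (n≡⌊n+n/2⌋ x)))

double-cancel-< : ∀ {x y} → x + x < y + y → x < y
double-cancel-< lt = ≰⇒> λ y≤x → <⇒≱ lt (+-mono-≤ y≤x y≤x)

-- The product `x * y` is common to both sides. In the application `c + y` and `d + x` are the
-- quotas of representatives and senators, the offset being `1` for an odd chamber and `2` for an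
-- even one.
cross-< : ∀ x y c d → x * c < y * d → x * (c + y) < y * (d + x)
cross-< x y c d lt = begin-strict
  x * (c + y)      ≡⟨ *-distribˡ-+ x c y ⟩
  x * c + x * y    <⟨ +-monoˡ-< (x * y) lt ⟩
  y * d + x * y    ≡⟨ cong (y * d +_) (*-comm x y) ⟩
  y * d + y * x    ≡⟨ *-distribˡ-+ y d x ⟨
  y * (d + x)      ∎
  where open ≤-Reasoning

criticalCount-majority-< : ∀ mₛ mᵣ → 0 < mₛ → 0 < mᵣ → mₛ < mᵣ →
  ((2 ∤ mₛ × 2 ∤ mᵣ) ⊎ (2 ∣ mₛ × 2 ∣ mᵣ) ⊎ (2 ∣ mₛ × 2 ∤ mᵣ) ⊎ (2 ∤ mₛ × 2 ∣ mᵣ × mᵣ > 2 * mₛ)) →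
  ∀ (i : Fin mₛ) (j : Fin mᵣ) k →
  let G  = bicameral mₛ mᵣ ⌈ mₛ + 1 /2⌉ ⌈ mᵣ + 1 /2⌉
      cₛ = criticalCount G (senator mᵣ i) k
      cᵣ = criticalCount G (representative mₛ j) k
  in cᵣ < cₛ ⊎ (cᵣ ≡ 0 × cₛ ≡ 0)
criticalCount-majority-< (suc m) (suc n) _ _ (s≤s m<n) (inj₁ (m-odd , n-odd))
  with odd-pred m m-odd | odd-pred n n-odd
... | x , refl | y , refl =
  criticalCount-< {q = x} {y} {y} {x} (majority-odd x) (majority-odd y) (<⇒≤ x<y) (cross-< x y 1 1 (*-monoˡ-< 1 x<y))
  where
  x<y : x < y
  x<y = double-cancel-< m<n
criticalCount-majority-< (suc m) (suc n) _ _ (s≤s m<n) (inj₂ (inj₁ (m-even , n-even)))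
  with even-pred m-even | even-pred n-even
... | x , refl | y , refl =
  criticalCount-< {q = suc x} {suc y} {y} {x} (majority-even x) (majority-even y) (s≤s (<⇒≤ x<y)) (cross-< x y 2 2 (*-monoˡ-< 2 x<y))
  where
  x<y : x < y
  x<y = double-cancel-< (s<s⁻¹ (subst₂ _<_ (+-suc x x) (+-suc y y) m<n))
criticalCount-majority-< (suc m) (suc n) _ _ (s≤s m<n) (inj₂ (inj₂ (inj₁ (m-even , n-odd))))
  with even-pred m-even | odd-pred n n-odd
... | x , refl | y , refl =
  -- The condition `q ≤ r` is here `suc x ≤ y`, that is, `x<y` itself.
  criticalCount-< {q = suc x} {y} {y} {x} (majority-even x) (majority-odd y) x<y
    (cross-< x y 1 2 (<-≤-trans (*-monoˡ-< 1 x<y) (*-monoʳ-≤ y (n≤1+n 1))))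
  where
  x<y : x < y
  x<y = double-cancel-< (<-trans (n<1+n (x + x)) (subst (_< y + y) (+-suc x x) m<n))
criticalCount-majority-< (suc m) (suc n) _ _ (s≤s m<n) (inj₂ (inj₂ (inj₂ (m-odd , n-even , 2m<n))))
  with odd-pred m m-odd | even-pred n-even
... | x , refl | y , refl =
  criticalCount-< {q = x} {suc y} {y} {x} (majority-odd x) (majority-even y) (m≤n⇒m≤1+n (≤-trans (m≤m+n x x) (<⇒≤ 2x<y)))
    (cross-< x y 2 1 (subst₂ _<_ (x+x≡x*2 x) (sym (*-identityʳ y)) 2x<y))
  where
  x+x≡x*2 : ∀ x → x + x ≡ x * 2
  x+x≡x*2 = solve-∀
  lhs : ∀ x → 2 * suc (x + x) ≡ 2 + ((x + x) + (x + x))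
  lhs = solve-∀
  -- The hypothesis reads `4x + 2 < 2y + 2` and halves to this, exactly the `x * 2 < y * 1` that
  -- `cross-<` needs when only the representatives' chamber is even.
  2x<y : x + x < y
  2x<y = double-cancel-< (s<s⁻¹ (s<s⁻¹ (subst₂ _<_ (lhs x) (cong suc (+-suc y y)) 2m<n)))

theorem1 : ∀ {c ℓ₁ ℓ₂} (mₛ mᵣ : ℕ) → 0 < mₛ → 0 < mᵣ → mₛ < mᵣ →
  ((2 ∤ mₛ × 2 ∤ mᵣ) ⊎ (2 ∣ mₛ × 2 ∣ mᵣ) ⊎ (2 ∣ mₛ × 2 ∤ mᵣ) ⊎ (2 ∤ mₛ × 2 ∣ mᵣ × mᵣ > 2 * mₛ)) →
  let G = bicameral mₛ mᵣ ⌈ mₛ + 1 /2⌉ ⌈ mᵣ + 1 /2⌉ in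
  ∀ (i : Fin mₛ) (j : Fin mᵣ) →
  let S = senator mᵣ i
      R = representative mₛ j in
  (∀ k → criticalCount G S k ≢ 0 → criticalCount G S k > criticalCount G R k)
  ×
  (∀ (F : OrderedField c ℓ₁ ℓ₂) (Φ : PowerIndex F (mₛ + mᵣ)) →
    let open OrderedField F
        open PowerIndex Φ in
    ¬ (power G S ≈ 0# × power G R ≈ 0#) → power G R <ᶠ power G S)
theorem1 mₛ mᵣ 0<mₛ 0<mᵣ mₛ<mᵣ parity i j =
  dominance (bicameral mₛ mᵣ ⌈ mₛ + 1 /2⌉ ⌈ mᵣ + 1 /2⌉) (representative mₛ j) (senator mᵣ i) (criticalCount-majority-< mₛ mᵣ 0<mₛ 0<mᵣ mₛ<mᵣ parity i j)
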